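{- Let $G$ be a finite simple graph with $n\ge 3$ vertices. Then $G$ is Hamiltonian and every Hamiltonian cycle of $G$ (viewed as a spanning subgraph) is a strong fixing subgraph of $G$ if and only if $G$ is isomorphic to one of: (i) the cycle $C_n$; (ii) the complete graph $K_n$; (iii) the complete bipartite graph $K_{n/2,n/2}$ (when $n$ is even).
   Context: A Hamiltonian cycle of $G$ is identified with the spanning subgraph of $G$ whose edges are the edges of the cycle. $A(H)$ denotes the automorphism group of $H$; for spanning subgraphs of $G$ these are subgroups of the symmetric group on $V(G)$. $s(U;G)$ is the number of spanning subgraphs of $G$ isomorphic to $U$. A spanning subgraph $U$ of $G$ is a strong fixing subgraph of $G$ if $s(U;G)=|A(G)|/|A(U)\cap A(G)|$ and $A(U)\subseteq A(G)$. The class of Hamiltonian graphs all of whose Hamiltonian cycles are strong fixing subgraphs is denoted $\mathcal{F}^*(\mathrm{HAM})$ in the paper. -}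

module Defs where

open import Data.Bool using (Bool; true; false; not; _∧_; _∨_; _xor_; T)
open import Data.Bool.Properties using (∨-comm)
open import Data.Nat using (ℕ; suc; _≡ᵇ_; _<ᵇ_; _+_; _*_)
open import Data.Fin using (Fin; toℕ)
open import Data.Fin.Permutation using (Permutation′; _⟨$⟩ʳ_)
open import Data.Product using (Σ; _×_; _,_)
open import Relation.Binary.PropositionalEquality using (_≡_; refl; sym; cong)

record SimpleGraph (n : ℕ) : Set where
  field
    adj    : Fin n → Fin n → Bool
    symm   : ∀ x y → adj x y ≡ adj y x
    irrefl : ∀ x → adj x x ≡ false
open SimpleGraph public

_≈G_ : ∀ {n} → SimpleGraph n → SimpleGraph n → Set
G ≈G H = ∀ x y → adj G x y ≡ adj H x y

_≈P_ : ∀ {n} → Permutation′ n → Permutation′ n → Set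
π ≈P ρ = ∀ x → π ⟨$⟩ʳ x ≡ ρ ⟨$⟩ʳ x

record Counts {A : Set} (_≈_ : A → A → Set) (P : A → Set) (k : ℕ) : Set where
  field
    elems    : Fin k → A
    inP      : ∀ i → P (elems i)
    distinct : ∀ i j → elems i ≈ elems j → i ≡ j
    complete : ∀ x → P x → Σ (Fin k) λ i → elems i ≈ x

IsAut : ∀ {n} → SimpleGraph n → Permutation′ n → Set
IsAut G π = ∀ x y → adj G (π ⟨$⟩ʳ x) (π ⟨$⟩ʳ y) ≡ adj G x y

AutSubset : ∀ {n} → SimpleGraph n → SimpleGraph n → Set
AutSubset U G = ∀ π → IsAut U π → IsAut G π

Iso : ∀ {n} → SimpleGraph n → SimpleGraph n → Set
Iso G H = Σ (Permutation′ _) λ π → ∀ x y → adj H (π ⟨$⟩ʳ x) (π ⟨$⟩ʳ y) ≡ adj G x y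

SpanningSub : ∀ {n} → SimpleGraph n → SimpleGraph n → Set
SpanningSub H G = ∀ x y → adj H x y ≡ true → adj G x y ≡ true

-- Strong fixing subgraphs:
--   s(U;G) = |A(G)| / |A(U) ∩ A(G)|   and   A(U) ⊆ A(G),
-- with the division written multiplicatively (|A(U) ∩ A(G)| ≥ 1).

StrongFixing : ∀ {n} → SimpleGraph n → SimpleGraph n → Set
StrongFixing {n} U G =
  (Σ ℕ λ a → Σ ℕ λ b → Σ ℕ λ s →
      Counts _≈P_ (IsAut G) a
    × Counts _≈P_ (λ π → IsAut U π × IsAut G π) b
    × Counts _≈G_ (λ H → SpanningSub H G × Iso H U) s
    × s * b ≡ a)
  × AutSubset U G

private
  eqF : ∀ {n} → Fin n → Fin n → Bool
  eqF x y = toℕ x ≡ᵇ toℕ y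

  ≡ᵇ-sym : ∀ m n → (m ≡ᵇ n) ≡ (n ≡ᵇ m)
  ≡ᵇ-sym 0 0 = refl
  ≡ᵇ-sym 0 (suc n) = refl
  ≡ᵇ-sym (suc m) 0 = refl
  ≡ᵇ-sym (suc m) (suc n) = ≡ᵇ-sym m n

  ≡ᵇ-refl : ∀ m → (m ≡ᵇ m) ≡ true
  ≡ᵇ-refl 0 = refl
  ≡ᵇ-refl (suc m) = ≡ᵇ-refl m

  eqF-sym : ∀ {n} (x y : Fin n) → eqF x y ≡ eqF y x
  eqF-sym x y = ≡ᵇ-sym (toℕ x) (toℕ y)

  eqF-refl : ∀ {n} (x : Fin n) → eqF x x ≡ true
  eqF-refl x = ≡ᵇ-refl (toℕ x)

  step : (n : ℕ) → Fin n → Fin n → Bool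
  step n x y = (suc (toℕ x) ≡ᵇ toℕ y) ∨ ((suc (toℕ x) ≡ᵇ n) ∧ (toℕ y ≡ᵇ 0))

cycleG : (n : ℕ) → SimpleGraph n
cycleG n = record
  { adj    = λ x y → not (eqF x y) ∧ (step n x y ∨ step n y x)
  ; symm   = λ x y → cong₂′ (cong not (eqF-sym x y)) (∨-comm (step n x y) (step n y x))
  ; irrefl = λ x → cong (λ b → not b ∧ (step n x x ∨ step n x x)) (eqF-refl x)
  }
  where
  cong₂′ : ∀ {a b c d : Bool} → a ≡ b → c ≡ d → (a ∧ c) ≡ (b ∧ d)
  cong₂′ refl refl = refl

completeG : (n : ℕ) → SimpleGraph n
completeG n = record
  { adj    = λ x y → not (eqF x y)
  ; symm   = λ x y → cong not (eqF-sym x y)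
  ; irrefl = λ x → cong not (eqF-refl x)
  }

-- The complete bipartite graph with parts {i | i < h} and {i | i ≥ h}
-- (this is K_{h,h} when n = h + h).
bipG : (n h : ℕ) → SimpleGraph n
bipG n h = record
  { adj    = λ x y → (toℕ x <ᵇ h) xor (toℕ y <ᵇ h)
  ; symm   = λ x y → xor-comm (toℕ x <ᵇ h) (toℕ y <ᵇ h)
  ; irrefl = λ x → xor-self (toℕ x <ᵇ h)
  }
  where
  xor-comm : ∀ a b → (a xor b) ≡ (b xor a)
  xor-comm true true = refl
  xor-comm true false = refl
  xor-comm false true = refl
  xor-comm false false = refl
  xor-self : ∀ a → (a xor a) ≡ false
  xor-self true = refl
  xor-self false = refl

IsHamCycle : ∀ {n} → SimpleGraph n → SimpleGraph n → Set
IsHamCycle {n} G H = SpanningSub H G × Iso H (cycleG n)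

{-# OPTIONS --safe #-}

-- Identify a Hamiltonian cycle of G with the standard cycle 0, 1, …, n-1. If its rotation is an
-- automorphism, then G is circulant: adjacency of i and i + d depends only on d; write S d for it.
-- If S k holds with 2 ≤ k ≤ n-3, then 0, k, k-1, …, 1, k+1, …, n-1 is another Hamiltonian cycle, and
-- comparing its rotation with that of the standard one gives S d = S (d + 2) for 1 ≤ d ≤ n-4.
-- Together with S 1 and S d = S (n - d) this leaves only the three graphs.
--
-- Conversely, each of the three graphs M contains the standard cycle and is rigid: every
-- permutation carrying that cycle to a Hamiltonian cycle of M is an automorphism of M. Hence
-- isomorphisms between Hamiltonian cycles are automorphisms, which gives A(H) ⊆ A(G) and the
-- transitivity of A(G) on Hamiltonian cycles; the count is then the orbit–stabiliser theorem.
module Submission where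

open import Defs
open import Data.Bool using (Bool; true; false; not; _∧_; _∨_; _xor_; T)
import Data.Bool.Properties as Bool
open import Data.Fin using (Fin; zero; suc; toℕ; cast; combine; remQuot; punchIn)
open import Data.Fin.Permutation as Perm using
  ( Permutation; Permutation′; permutation; _⟨$⟩ʳ_; _⟨$⟩ˡ_; inverseˡ; inverseʳ; flip; _∘ₚ_
  ; cast-id; insert; remove; insert-remove )
open import Data.Fin.Properties as Fin using
  ( all?; toℕ-fromℕ<; toℕ-injective; toℕ<n; toℕ-cast; toℕ-combine; combine-remQuot; remQuot-combine )
open import Data.List using
  ( List; []; _∷_; length; lookup; map; filter; deduplicate; allFin; cartesianProductWith )
open import Data.List.Membership.Propositional.Properties using (∈-allFin; ∈-lookup)
import Data.List.Membership.Setoid as Membership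
import Data.List.Membership.Setoid.Properties as Membershipₚ
import Data.List.Relation.Unary.All as All
open import Data.List.Relation.Unary.AllPairs using (_∷_)
open import Data.List.Relation.Unary.Any as Any using (here)
open import Data.List.Relation.Unary.Any.Properties as Anyₚ using (lookup-index)
import Data.List.Relation.Unary.Unique.DecSetoid.Properties as UniqueDec
import Data.List.Relation.Unary.Unique.Setoid as Unique
open import Data.Nat using
  ( ℕ; zero; suc; pred; _≤_; _<_; _+_; _*_; _∸_; _≤?_; _≡ᵇ_; _<ᵇ_; z≤n; s≤s
  ; NonZero; >-nonZero; >-nonZero⁻¹ )
open import Data.Nat.DivMod using (_%_; _mod_; m<n⇒m%n≡m; m%n%n≡m%n; %-distribˡ-+; [m+n]%n≡m%n)
open import Data.Nat.Properties hiding (_≟_)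
open import Data.Product using (Σ; ∃; _×_; _,_; proj₁; proj₂)
open import Data.Sum using (_⊎_; inj₁; inj₂; [_,_]′)
import Data.Vec.Functional.Relation.Binary.Pointwise.Properties as Pointwise
open import Function using (_∘_; case_of_)
open import Function.Bundles using (Equivalence; mk⇔; _⇔_)
open import Level using (0ℓ)
open import Relation.Binary using (Setoid; DecSetoid; _Respects_)
import Relation.Binary.Construct.On as On
open import Relation.Binary.PropositionalEquality using
  (_≡_; _≢_; refl; sym; trans; cong; cong₂; subst; subst₂; module ≡-Reasoning)
open import Relation.Nullary using (yes; no; contradiction; _×-dec_)
open import Relation.Unary using (Decidable)

-- Counting the classes of a finite setoid.

module _ (S : Setoid 0ℓ 0ℓ) where
  open Setoid S using (_≈_) renaming (Carrier to A; sym to ≈-sym)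
  open Unique S using (Unique)

  lookup-injective : ∀ {xs : List A} → Unique xs → ∀ i j → lookup xs i ≈ lookup xs j → i ≡ j
  lookup-injective (_ ∷ _)  zero    zero    _ = refl
  lookup-injective (x∉ ∷ _) zero    (suc j) e = contradiction e (All.lookup x∉ (∈-lookup j))
  lookup-injective (x∉ ∷ _) (suc i) zero    e = contradiction (≈-sym e) (All.lookup x∉ (∈-lookup i))
  lookup-injective (_ ∷ u)  (suc i) (suc j) e = cong suc (lookup-injective u i j e)

module _ (S : DecSetoid 0ℓ 0ℓ) where
  open DecSetoid S using (_≈_; _≟_; setoid) renaming (Carrier to A; sym to ≈-sym; trans to ≈-trans)
  open Membership setoid using (_∈_)

  -- The list may meet a class several times; deduplication keeps one representative of each, so the
  -- positions of the shortened list are the required indices.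
  counts : ∀ {P : A → Set} (xs : List A) → (∀ {x} → x ∈ xs → P x) → (∀ x → P x → x ∈ xs) →
           Σ ℕ (Counts _≈_ P)
  counts xs sound covers = length ys , record
    { elems    = lookup ys
    ; inP      = λ i → sound (Membershipₚ.∈-deduplicate⁻ setoid _≟_ xs (Membershipₚ.∈-lookup setoid ys i))
    ; distinct = lookup-injective setoid (UniqueDec.deduplicate-! S xs)
    ; complete = λ x Px →
        let x∈ys = Membershipₚ.∈-deduplicate⁺ setoid _≟_ (λ p q → ≈-trans q (≈-sym p)) (covers x Px)
        in Any.index x∈ys , ≈-sym (lookup-index x∈ys)
    }
    where ys = deduplicate _≟_ xs

-- Enumeration of all permutations.

permDecSetoid : ℕ → DecSetoid 0ℓ 0ℓ
permDecSetoid n = On.decSetoid (Pointwise.decSetoid (Fin.≡-decSetoid n) n) (_⟨$⟩ʳ_ {n} {n})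

graphDecSetoid : ℕ → DecSetoid 0ℓ 0ℓ
graphDecSetoid n = On.decSetoid (Pointwise.decSetoid (Pointwise.decSetoid Bool.≡-decSetoid n) n) (adj {n})

module PermSetoid n = DecSetoid (permDecSetoid n)
module PermMembership n = Membership (PermSetoid.setoid n)

permutations : ∀ n → List (Permutation′ n)
permutations zero    = Perm.id ∷ []
permutations (suc n) = cartesianProductWith (insert zero) (allFin (suc n)) (permutations n)

insert-cong : ∀ {n} (i : Fin (suc n)) {j} {π ρ : Permutation′ n} → π ≈P ρ → insert i j π ≈P insert i j ρ
insert-cong i π≈ρ k with i Fin.≟ k
... | yes _ = refl
... | no  _ = cong (punchIn _) (π≈ρ _)

-- By `insert-remove`, a permutation is recovered from its value at `zero` and the permutation of
-- the remaining points.
∈-permutations : ∀ n (π : Permutation′ n) → PermMembership._∈_ n π (permutations n)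
∈-permutations zero    π = here λ ()
∈-permutations (suc n) π =
  Anyₚ.cartesianProductWith⁺ (insert zero)
    (λ { {y = ρ} refl rπ≈ρ k →
         trans (sym (insert-remove zero π k)) (insert-cong zero {π = remove zero π} {ρ} rπ≈ρ k) })
    (∈-allFin (π ⟨$⟩ʳ zero)) (∈-permutations n (remove zero π))

-- Automorphisms, copies of a subgraph, and orbit-stabiliser.

module _ {n : ℕ} where
  countPermutations : ∀ {P : Permutation′ n → Set} → Decidable P → P Respects _≈P_ → Σ ℕ (Counts _≈P_ P)
  countPermutations P? resp = counts (permDecSetoid n) (filter P? (permutations n))
    (proj₂ ∘ Membershipₚ.∈-filter⁻ setoid P? resp {xs = permutations n})
    (λ π Pπ → Membershipₚ.∈-filter⁺ setoid P? resp (∈-permutations n π) Pπ)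
    where open PermSetoid n using (setoid)

  isAut? : (G : SimpleGraph n) → Decidable (IsAut G)
  isAut? G π = all? λ x → all? λ y → adj G (π ⟨$⟩ʳ x) (π ⟨$⟩ʳ y) Bool.≟ adj G x y

  -- The preimage of a graph, so that `π` is an isomorphism from `pull π G` to `G`. The image of `H`
  -- under `π` is therefore `pull (flip π) H`.
  pull : Permutation′ n → SimpleGraph n → SimpleGraph n
  pull π G = record
    { adj    = λ x y → adj G (π ⟨$⟩ʳ x) (π ⟨$⟩ʳ y)
    ; symm   = λ x y → symm G _ _
    ; irrefl = λ x → irrefl G _
    }

  IsIso : SimpleGraph n → SimpleGraph n → Permutation′ n → Set
  IsIso G H π = ∀ x y → adj H (π ⟨$⟩ʳ x) (π ⟨$⟩ʳ y) ≡ adj G x y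

  isIso-resp : ∀ {G H} → IsIso G H Respects _≈P_
  isIso-resp {G} {H} π≈ρ iso x y = trans (sym (cong₂ (adj H) (π≈ρ x) (π≈ρ y))) (iso x y)

  isIso-flip : ∀ {G H} π → IsIso G H π → IsIso H G (flip π)
  isIso-flip {G} {H} π iso x y =
    trans (sym (iso _ _)) (cong₂ (adj H) (inverseʳ π) (inverseʳ π))

  isIso-∘ : ∀ {G H K} π ρ → IsIso G H π → IsIso H K ρ → IsIso G K (π ∘ₚ ρ)
  isIso-∘ π ρ isoπ isoρ x y = trans (isoρ _ _) (isoπ x y)

  image-copy : ∀ {G H} → SpanningSub H G → ∀ π → IsAut G π →
               SpanningSub (pull (flip π) H) G × Iso (pull (flip π) H) H
  image-copy {G} H⊆G π aut =
    (λ x y e → trans (sym (isIso-flip {G} {G} π aut x y)) (H⊆G _ _ e)) , flip π , λ _ _ → refl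

  TransitiveOnCopies : SimpleGraph n → SimpleGraph n → Set
  TransitiveOnCopies G H =
    ∀ H′ → SpanningSub H′ G → Iso H′ H → Σ (Permutation′ n) λ σ → IsAut G σ × IsIso H H′ σ

  -- By transitivity every copy is the image of `H` under an automorphism of `G`, so it suffices to
  -- list these images; no search through all graphs is made.
  countCopies : ∀ {G H} → SpanningSub H G → TransitiveOnCopies G H →
                Σ ℕ (Counts _≈G_ (λ H′ → SpanningSub H′ G × Iso H′ H))
  countCopies {G} {H} H⊆G transitive = counts (graphDecSetoid n) (map image auts) (λ {H′} → sound {H′}) covers
    where
    open PermSetoid n using (setoid)
    open PermMembership n using (_∈_)
    open DecSetoid (graphDecSetoid n) using () renaming (setoid to graphSetoid)
    open Membership graphSetoid using () renaming (_∈_ to _∈G_)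

    image : Permutation′ n → SimpleGraph n
    image π = pull (flip π) H

    resp : IsAut G Respects _≈P_
    resp {π} {ρ} = isIso-resp {G} {G} {π} {ρ}

    auts : List (Permutation′ n)
    auts = filter (isAut? G) (permutations n)

    auts-sound : ∀ {π} → π ∈ auts → IsAut G π
    auts-sound {π} π∈ = proj₂
      (Membershipₚ.∈-filter⁻ setoid (isAut? G) (λ {π} {ρ} → resp {π} {ρ}) {v = π} {xs = permutations n} π∈)

    sound : ∀ {H′} → H′ ∈G map image auts → SpanningSub H′ G × Iso H′ H
    sound {H′} H′∈ =
      let π , π∈ , H′≈ = Membershipₚ.∈-map⁻ setoid graphSetoid {v = H′} {xs = auts} {f = image} H′∈
          sub , φ , iso = image-copy {G} {H} H⊆G π (auts-sound {π} π∈)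
      in (λ x y e → sub x y (trans (sym (H′≈ x y)) e)) , φ , λ x y → trans (iso x y) (sym (H′≈ x y))

    covers : ∀ H′ → SpanningSub H′ G × Iso H′ H → H′ ∈G map image auts
    covers H′ (sub , iso) =
      let σ , aut , isoσ = transitive H′ sub iso in
      Anyₚ.map⁺ (Any.map
        (λ {ρ} σ≈ρ x y → sym (isIso-flip {H} {H′} ρ (isIso-resp {H} {H′} {σ} {ρ} σ≈ρ isoσ) x y))
        (Membershipₚ.∈-filter⁺ setoid (isAut? G) (λ {π} {ρ} → resp {π} {ρ}) {v = σ} {xs = permutations n}
          (∈-permutations n σ) aut))

  countStabiliser : ∀ G H → Σ ℕ (Counts _≈P_ (λ π → IsAut H π × IsAut G π))
  countStabiliser G H = countPermutations (λ π → isAut? H π ×-dec isAut? G π)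
    (λ {π} {ρ} π≈ρ (p , q) → isIso-resp {H} {H} {π} {ρ} π≈ρ p , isIso-resp {G} {G} {π} {ρ} π≈ρ q)

  -- If Aut G is transitive on the copies of H in G, then choosing an automorphism H → H′
  -- for each copy H′ enumerates Aut G by pairs (copy, stabiliser element).
  orbit-stabiliser : ∀ {G H s b} → SpanningSub H G → TransitiveOnCopies G H →
    Counts _≈G_ (λ H′ → SpanningSub H′ G × Iso H′ H) s →
    Counts _≈P_ (λ π → IsAut H π × IsAut G π) b →
    Counts _≈P_ (IsAut G) (s * b)
  orbit-stabiliser {G} {H} {s} {b} H⊆G transitive cS cB = record
    { elems    = element ∘ remQuot b
    ; inP      = λ i → element-aut (remQuot b i)
    ; distinct = λ i j e → trans (sym (combine-remQuot {s} b i))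
        (trans (cong (λ (p , q) → combine p q) (element-injective (remQuot b i) (remQuot b j) e))
          (combine-remQuot {s} b j))
    ; complete = λ π aut → let (p , q) , e = element-surjective π aut in
        combine p q , λ x → trans (cong (λ pq → element pq ⟨$⟩ʳ x) (remQuot-combine p q)) (e x)
    }
    where
    module S = Counts cS
    module B = Counts cB

    transport : ∀ p → Σ (Permutation′ n) λ σ → IsAut G σ × IsIso H (S.elems p) σ
    transport p = transitive (S.elems p) (proj₁ (S.inP p)) (proj₂ (S.inP p))

    σ : Fin s → Permutation′ n
    σ p = proj₁ (transport p)

    σ-aut : ∀ p → IsAut G (σ p)
    σ-aut p = proj₁ (proj₂ (transport p))

    σ-iso : ∀ p → IsIso H (S.elems p) (σ p)
    σ-iso p = proj₂ (proj₂ (transport p))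

    element : Fin s × Fin b → Permutation′ n
    element (p , q) = B.elems q ∘ₚ σ p

    element-aut : ∀ pq → IsAut G (element pq)
    element-aut (p , q) = isIso-∘ {G} {G} {G} (B.elems q) (σ p) (proj₂ (B.inP q)) (σ-aut p)

    element-iso : ∀ p q → IsIso H (S.elems p) (element (p , q))
    element-iso p q = isIso-∘ {H} {H} {S.elems p} (B.elems q) (σ p) (proj₁ (B.inP q)) (σ-iso p)

    -- Both sides are the image of `H` under the same permutation, so a product determines the copy
    -- from which it was built.
    element-image : ∀ p q p′ q′ → element (p , q) ≈P element (p′ , q′) → S.elems p ≈G S.elems p′
    element-image p q p′ q′ e x y =
      trans (sym (isIso-flip {H} {S.elems p} π (element-iso p q) x y))
        (trans (sym (element-iso p′ q′ _ _))
          (cong₂ (adj (S.elems p′)) (trans (sym (e _)) (inverseʳ π)) (trans (sym (e _)) (inverseʳ π))))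
      where π = element (p , q)

    element-injective : ∀ pq pq′ → element pq ≈P element pq′ → pq ≡ pq′
    element-injective (p , q) (p′ , q′) e with refl ← S.distinct p p′ (element-image p q p′ q′ e) =
      cong (p ,_) (B.distinct q q′ λ x →
        trans (sym (inverseˡ (σ p))) (trans (cong (σ p ⟨$⟩ˡ_) (e x)) (inverseˡ (σ p))))

    -- Take for `p` the index of the image of `H` under `π`. Undoing `σ p` after `π` then fixes `H`,
    -- which gives the stabiliser element `q`.
    element-surjective : ∀ π → IsAut G π → ∃ λ pq → element pq ≈P π
    element-surjective π aut =
      let p , Hp≈ = S.complete (pull (flip π) H) (image-copy {G} {H} H⊆G π aut)
          q , τ≈ = B.complete (π ∘ₚ flip (σ p))
            ( isIso-∘ {H} {S.elems p} {H} π (flip (σ p))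
                (λ x y → trans (Hp≈ _ _) (cong₂ (adj H) (inverseˡ π) (inverseˡ π)))
                (isIso-flip {H} {S.elems p} (σ p) (σ-iso p))
            , isIso-∘ {G} {G} {G} π (flip (σ p)) aut (isIso-flip {G} {G} (σ p) (σ-aut p)))
      in (p , q) , λ x → trans (cong (σ p ⟨$⟩ʳ_) (τ≈ x)) (inverseʳ (σ p))

  strongFixing : ∀ {G H} → SpanningSub H G → TransitiveOnCopies G H → AutSubset H G → StrongFixing H G
  strongFixing {G} {H} H⊆G transitive autSub =
    let s , cS = countCopies {G} {H} H⊆G transitive
        b , cB = countStabiliser G H
    in (s * b , b , s , orbit-stabiliser {G} {H} H⊆G transitive cS cB , cB , cS , refl) , autSub

-- Parity and the balanced complete bipartite graph.

odd : ℕ → Bool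
odd zero    = false
odd (suc n) = not (odd n)

xor-cancelʳ : ∀ a b c → (a xor c) xor (b xor c) ≡ a xor b
xor-cancelʳ false false false = refl
xor-cancelʳ false false true  = refl
xor-cancelʳ false true  false = refl
xor-cancelʳ false true  true  = refl
xor-cancelʳ true  false false = refl
xor-cancelʳ true  false true  = refl
xor-cancelʳ true  true  false = refl
xor-cancelʳ true  true  true  = refl

xor-true⇒not : ∀ a b → a xor b ≡ true → b ≡ not a
xor-true⇒not false b e = e
xor-true⇒not true  b e = trans (sym (Bool.not-involutive b)) (cong not e)

xor-not : ∀ a → a xor not a ≡ true
xor-not false = refl
xor-not true  = refl

≢⇒not≡ᵇ : ∀ {a b} → a ≢ b → not (a ≡ᵇ b) ≡ true
≢⇒not≡ᵇ {a} {b} a≢b with a ≡ᵇ b in eq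
... | true  = contradiction (≡ᵇ⇒≡ a b (Equivalence.from Bool.T-≡ eq)) a≢b
... | false = refl

-- For even `n` this is the balanced complete bipartite graph, with the even and the odd vertices as
-- parts so that the standard cycle lies in it.
parityG : ∀ n → SimpleGraph n
parityG n = record
  { adj    = λ x y → odd (toℕ x) xor odd (toℕ y)
  ; symm   = λ x y → Bool.xor-comm (odd (toℕ x)) (odd (toℕ y))
  ; irrefl = λ x → Bool.xor-same (odd (toℕ x))
  }

perm-injective : ∀ {n} (π : Permutation′ n) {x y} → π ⟨$⟩ʳ x ≡ π ⟨$⟩ʳ y → x ≡ y
perm-injective π e = trans (sym (inverseˡ π)) (trans (cong (π ⟨$⟩ˡ_) e) (inverseˡ π))

-- Vertices as residues modulo n, and rigidity of the three graphs.

module Cyclic (n : ℕ) .⦃ _ : NonZero n ⦄ where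
  ι : ℕ → Fin n
  ι k = k mod n

  toℕ-ι : ∀ k → toℕ (ι k) ≡ k % n
  toℕ-ι k = toℕ-fromℕ< _

  toℕ-ι-< : ∀ {k} → k < n → toℕ (ι k) ≡ k
  toℕ-ι-< k<n = trans (toℕ-ι _) (m<n⇒m%n≡m k<n)

  ι-cong : ∀ {a b} → a % n ≡ b % n → ι a ≡ ι b
  ι-cong e = toℕ-injective (trans (toℕ-ι _) (trans e (sym (toℕ-ι _))))

  ι-toℕ : ∀ x → ι (toℕ x) ≡ x
  ι-toℕ x = toℕ-injective (toℕ-ι-< (toℕ<n x))

  ι-shift : ∀ c k → ι (c + toℕ (ι k)) ≡ ι (c + k)
  ι-shift c k = ι-cong (begin
    (c + toℕ (ι k)) % n       ≡⟨ cong (λ t → (c + t) % n) (toℕ-ι k) ⟩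
    (c + k % n) % n           ≡⟨ %-distribˡ-+ c (k % n) n ⟩
    (c % n + k % n % n) % n   ≡⟨ cong (λ t → (c % n + t) % n) (m%n%n≡m%n k n) ⟩
    (c % n + k % n) % n       ≡⟨ %-distribˡ-+ c k n ⟨
    (c + k) % n               ∎)
    where open ≡-Reasoning

  ι-period : ∀ k → ι (n + k) ≡ ι k
  ι-period k = ι-cong (trans (cong (_% n) (+-comm n k)) ([m+n]%n≡m%n k n))

  ι-n : ι n ≡ ι 0
  ι-n = trans (cong ι (sym (+-identityʳ n))) (ι-period 0)

  next : Fin n → Fin n
  next x = ι (suc (toℕ x))

  -- Adding `n - 1` modulo `n` avoids a special case at vertex 0.
  prev : Fin n → Fin n
  prev x = ι (pred n + toℕ x)

  next-ι : ∀ k → next (ι k) ≡ ι (suc k)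
  next-ι = ι-shift 1

  ι-pred-suc : ∀ x → ι (suc (pred n) + toℕ x) ≡ x
  ι-pred-suc x = trans (cong (λ m → ι (m + toℕ x)) (suc-pred n)) (trans (ι-period _) (ι-toℕ x))

  next-prev : ∀ x → next (prev x) ≡ x
  next-prev x = trans (next-ι _) (ι-pred-suc x)

  prev-next : ∀ x → prev (next x) ≡ x
  prev-next x = trans (ι-shift (pred n) _) (trans (cong ι (+-suc (pred n) (toℕ x))) (ι-pred-suc x))

  rotation : Permutation′ n
  rotation = permutation next prev next-prev prev-next

  next-injective : ∀ {x y} → next x ≡ next y → x ≡ y
  next-injective = perm-injective rotation

  next-cases : ∀ x → (suc (toℕ x) < n × toℕ (next x) ≡ suc (toℕ x)) ⊎ (suc (toℕ x) ≡ n × next x ≡ ι 0)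
  next-cases x with m≤n⇒m<n∨m≡n (toℕ<n x)
  ... | inj₁ lt = inj₁ (lt , toℕ-ι-< lt)
  ... | inj₂ eq = inj₂ (eq , trans (cong ι eq) ι-n)

  toℕ-ι0 : toℕ (ι 0) ≡ 0
  toℕ-ι0 = trans (toℕ-ι 0) (m<n⇒m%n≡m (>-nonZero⁻¹ n))

  Alternating : (Fin n → Bool) → Set
  Alternating c = ∀ x → c (next x) ≡ not (c x)

  alternating : ∀ {c} → Alternating c → ∀ x → c x ≡ odd (toℕ x) xor c (ι 0)
  alternating {c} alt x = trans (cong c (sym (ι-toℕ x))) (at (toℕ x))
    where
    at : ∀ k → c (ι k) ≡ odd k xor c (ι 0)
    at zero    = refl
    at (suc k) = trans (cong c (sym (next-ι k))) (trans (alt (ι k))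
                   (trans (cong not (at k)) (Bool.not-distribˡ-xor (odd k) (c (ι 0)))))

  odd-alternating : odd n ≡ false → Alternating (odd ∘ toℕ)
  odd-alternating even x with next-cases x
  ... | inj₁ (_ , e) = cong odd e
  -- The evenness of `n` enters at the closing edge, from `n - 1` back to 0.
  ... | inj₂ (e , f) = trans (cong (odd ∘ toℕ) f) (trans (cong odd toℕ-ι0) (sym (trans (cong odd e) even)))

  -- β(0), β(1), …, β(n-1) is a Hamiltonian cycle of G.
  Embeds : SimpleGraph n → Permutation′ n → Set
  Embeds G β = ∀ x → adj G (β ⟨$⟩ʳ x) (β ⟨$⟩ʳ next x) ≡ true

  Rigid : SimpleGraph n → Set
  Rigid G = ∀ β → Embeds G β → IsAut G β

  -- The parity of `β(x)` flips along each edge of the cycle, so it is the parity of `x` up to a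
  -- constant, and the constant cancels in `xor`.
  parity-rigid : Rigid (parityG n)
  parity-rigid β emb x y =
    trans (cong₂ _xor_ (alternating alt x) (alternating alt y))
      (xor-cancelʳ (odd (toℕ x)) (odd (toℕ y)) (odd (toℕ (β ⟨$⟩ʳ ι 0))))
    where
    alt : Alternating (λ x → odd (toℕ (β ⟨$⟩ʳ x)))
    alt x = xor-true⇒not _ _ (emb x)

  complete-edge : ∀ {x y} → x ≢ y → adj (completeG n) x y ≡ true
  complete-edge x≢y = ≢⇒not≡ᵇ (x≢y ∘ toℕ-injective)

  complete-aut : ∀ π → IsAut (completeG n) π
  complete-aut π x y with x Fin.≟ y
  ... | yes refl = trans (irrefl (completeG n) (π ⟨$⟩ʳ x)) (sym (irrefl (completeG n) x))
  ... | no x≢y   = trans (complete-edge (x≢y ∘ perm-injective π)) (sym (complete-edge x≢y))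

  -- The Boolean expression is the private `step n x y` of `cycleG`, written out.
  successor : ∀ x y → T ((suc (toℕ x) ≡ᵇ toℕ y) ∨ ((suc (toℕ x) ≡ᵇ n) ∧ (toℕ y ≡ᵇ 0))) → y ≡ next x
  successor x y t with Equivalence.to Bool.T-∨ t
  ... | inj₁ e = trans (sym (ι-toℕ y)) (cong ι (sym (≡ᵇ⇒≡ (suc (toℕ x)) (toℕ y) e)))
  ... | inj₂ e with e₁ , e₂ ← Equivalence.to (Bool.T-∧ {suc (toℕ x) ≡ᵇ n}) e =
    trans (toℕ-injective (trans (≡ᵇ⇒≡ (toℕ y) 0 e₂) (sym toℕ-ι0)))
      (sym (trans (cong ι (≡ᵇ⇒≡ (suc (toℕ x)) n e₁)) ι-n))

  next-successor : ∀ x → T ((suc (toℕ x) ≡ᵇ toℕ (next x)) ∨ ((suc (toℕ x) ≡ᵇ n) ∧ (toℕ (next x) ≡ᵇ 0)))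
  next-successor x with next-cases x
  ... | inj₁ (_ , e) = Equivalence.from Bool.T-∨ (inj₁ (≡⇒≡ᵇ (suc (toℕ x)) (toℕ (next x)) (sym e)))
  ... | inj₂ (e , f) = Equivalence.from (Bool.T-∨ {suc (toℕ x) ≡ᵇ toℕ (next x)})
          (inj₂ (Equivalence.from Bool.T-∧ (≡⇒≡ᵇ (suc (toℕ x)) n e , ≡⇒≡ᵇ (toℕ (next x)) 0 (trans (cong toℕ f) toℕ-ι0))))

  Neighbours : Fin n → Fin n → Set
  Neighbours x y = y ≡ next x ⊎ x ≡ next y

  cycle-edge⁻ : ∀ x y → adj (cycleG n) x y ≡ true → Neighbours x y
  cycle-edge⁻ x y e
    with Equivalence.to Bool.T-∨
           (proj₂ (Equivalence.to (Bool.T-∧ {not (toℕ x ≡ᵇ toℕ y)}) (Equivalence.from Bool.T-≡ e)))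
  ... | inj₁ t = inj₁ (successor x y t)
  ... | inj₂ t = inj₂ (successor y x t)

  edge-sym : ∀ (G : SimpleGraph n) {x y} → adj G x y ≡ true → adj G y x ≡ true
  edge-sym G {x} {y} e = trans (symm G y x) e

  embeds⇒edge : ∀ G {β x y} → Embeds G β → Neighbours x y → adj G (β ⟨$⟩ʳ x) (β ⟨$⟩ʳ y) ≡ true
  embeds⇒edge G emb (inj₁ refl) = emb _
  embeds⇒edge G {y = y} emb (inj₂ refl) = edge-sym G {_} {_} (emb y)

  module _ (3≤n : 3 ≤ n) where
    1<n : 1 < n
    1<n = ≤-trans (s≤s (s≤s z≤n)) 3≤n

    next≢ : ∀ x → x ≢ next x
    next≢ x e with next-cases x
    ... | inj₁ (_ , f) = 1+n≢n (sym (trans (cong toℕ e) f))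
    ... | inj₂ (f , g) = <⇒≢ 1<n (trans (cong suc (sym (trans (cong toℕ (trans e g)) toℕ-ι0))) f)

    -- Two steps returning to the start would force a cycle of length at most 2. This is what makes
    -- the two neighbours of a vertex distinct.
    next-next≢ : ∀ x → x ≢ next (next x)
    next-next≢ x e with next-cases x
    ... | inj₂ (f , g) = <⇒≢ 3≤n (trans (cong suc (sym (trans (cong toℕ e)
            (trans (cong (toℕ ∘ next) g) (trans (cong toℕ (next-ι 0)) (toℕ-ι-< 1<n)))))) f)
    ... | inj₁ (_ , f) with next-cases (next x)
    ...   | inj₁ (_ , g) = m≢1+n+m _ {1} (trans (cong toℕ e) (trans g (cong suc f)))
    ...   | inj₂ (g , h) = <⇒≢ 3≤n
              (trans (cong (2 +_) (sym (trans (cong toℕ (trans e h)) toℕ-ι0))) (trans (cong suc (sym f)) g))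

    cycle-next : ∀ x → adj (cycleG n) x (next x) ≡ true
    cycle-next x = Equivalence.to Bool.T-≡ (Equivalence.from Bool.T-∧
      ( Equivalence.from Bool.T-≡ (≢⇒not≡ᵇ (next≢ x ∘ toℕ-injective))
      , Equivalence.from Bool.T-∨ (inj₁ (next-successor x))))

    cycle-edge⁺ : ∀ {x y} → Neighbours x y → adj (cycleG n) x y ≡ true
    cycle-edge⁺ = embeds⇒edge (cycleG n) {Perm.id} cycle-next

    -- A vertex of the cycle has only two neighbours, and β already realises both as images
    -- of neighbours.
    cycle-rigid : Rigid (cycleG n)
    cycle-rigid β emb x y = Bool.⇔→≡ (mk⇔ reflects (λ e → embeds⇒edge (cycleG n) {β} emb (cycle-edge⁻ x y e)))
      where
      b : Fin n → Fin n
      b = β ⟨$⟩ʳ_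
      b-next : Neighbours (b x) (b (next x))
      b-next = cycle-edge⁻ _ _ (emb x)
      b-prev : Neighbours (b x) (b (prev x))
      b-prev = cycle-edge⁻ _ _ (embeds⇒edge (cycleG n) {β} emb (inj₂ (sym (next-prev x))))
      next≢prev : b (next x) ≢ b (prev x)
      next≢prev e = next-next≢ (prev x) (sym (trans (cong next (next-prev x)) (perm-injective β e)))
      is-next : b y ≡ b (next x) → adj (cycleG n) x y ≡ true
      is-next e = cycle-edge⁺ (inj₁ (perm-injective β e))
      is-prev : b y ≡ b (prev x) → adj (cycleG n) x y ≡ true
      is-prev e = cycle-edge⁺ (inj₂ (sym (trans (cong next (perm-injective β e)) (next-prev x))))
      -- Here `s` and `t` stand for `next (b x)` and `b x`, as variables so that `refl` can be
      -- matched. Each alternative admits only one vertex, so the distinct `p` and `q` exhaust both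
      -- and `r` is one of them.
      decide : ∀ {p q r s t : Fin n} → p ≡ s ⊎ t ≡ next p → q ≡ s ⊎ t ≡ next q → p ≢ q →
               r ≡ s ⊎ t ≡ next r → r ≡ p ⊎ r ≡ q
      decide (inj₁ refl) (inj₁ refl) p≢q _ = contradiction refl p≢q
      decide (inj₁ refl) (inj₂ f) _ (inj₁ refl) = inj₁ refl
      decide (inj₁ refl) (inj₂ f) _ (inj₂ h) = inj₂ (next-injective (trans (sym h) f))
      decide (inj₂ f) (inj₁ refl) _ (inj₁ refl) = inj₂ refl
      decide (inj₂ f) (inj₁ refl) _ (inj₂ h) = inj₁ (next-injective (trans (sym h) f))
      decide (inj₂ f) (inj₂ g) p≢q _ = contradiction (next-injective (trans (sym f) g)) p≢q
      reflects : adj (cycleG n) (b x) (b y) ≡ true → adj (cycleG n) x y ≡ true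
      reflects e = [ is-next , is-prev ]′ (decide b-next b-prev next≢prev (cycle-edge⁻ _ _ e))

    rotation-aut : IsAut (cycleG n) rotation
    rotation-aut = cycle-rigid rotation (λ x → cycle-next (next x))

-- Reversal of the segment 1, ..., k.

reverseUpTo : ℕ → ℕ → ℕ
reverseUpTo k zero    = zero
reverseUpTo k (suc i) with suc i ≤? k
-- The argument is `suc i`, whose mirror image in 1, ..., k is `k + 1 - (i + 1)`.
... | yes _ = k ∸ i
... | no  _ = suc i

reverse-inside : ∀ {k} i j → suc i + j ≡ k → reverseUpTo k (suc i) ≡ suc j
reverse-inside {k} i j e with suc i ≤? k
... | yes _   = trans (cong (_∸ i) (trans (sym e) (sym (+-suc i j)))) (m+n∸m≡n i (suc j))
... | no  i≰k = contradiction (subst (suc i ≤_) e (m≤m+n (suc i) j)) i≰k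

reverse-outside : ∀ {k} i → k < i → reverseUpTo k i ≡ i
reverse-outside zero    _ = refl
reverse-outside {k} (suc i) k<i with suc i ≤? k
... | yes i≤k = contradiction k<i (≤⇒≯ i≤k)
... | no  _   = refl

-- Inside the segment the complement `j` is recorded together with `i`: the reversal exchanges
-- `suc i` and `suc j`, and no truncated subtraction remains.
data Position (k : ℕ) : ℕ → Set where
  start   : Position k 0
  inside  : ∀ i j → suc i + j ≡ k → Position k (suc i)
  outside : ∀ {i} → k < i → Position k i

position : ∀ k i → Position k i
position k zero    = start
position k (suc i) with suc i ≤? k
... | yes i≤k = inside i (k ∸ suc i) (m+[n∸m]≡n i≤k)
... | no  i≰k = outside (≰⇒> i≰k)

reverse-involutive : ∀ k i → reverseUpTo k (reverseUpTo k i) ≡ i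
reverse-involutive k i with position k i
... | start        = refl
... | inside i j e = trans (cong (reverseUpTo k) (reverse-inside i j e))
                       (reverse-inside j i (trans (cong suc (+-comm j i)) e))
... | outside k<i  = trans (cong (reverseUpTo k) (reverse-outside i k<i)) (reverse-outside i k<i)

reverse-< : ∀ {k n i} → k < n → i < n → reverseUpTo k i < n
reverse-< {k} {n} {i} k<n i<n with position k i
... | start        = i<n
... | inside i j e = ≤-<-trans
        (≤-trans (≤-reflexive (reverse-inside i j e))
          (subst (suc j ≤_) e (s≤s (m≤n+m j i)))) k<n
... | outside k<i  = subst (_< n) (sym (reverse-outside i k<i)) i<n

1+pred≡ : ∀ {k} → 2 ≤ k → suc (pred k) ≡ k
1+pred≡ 2≤k = suc-pred _ ⦃ >-nonZero (<⇒≤ 2≤k) ⦄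

-- Circulant graphs and their classification.

module Circulant (n : ℕ) .⦃ _ : NonZero n ⦄ where
  open Cyclic n

  segmentReversal : ∀ {k} → k < n → Permutation′ n
  segmentReversal {k} k<n = permutation f f involutive involutive
    where
    f : Fin n → Fin n
    f x = ι (reverseUpTo k (toℕ x))
    involutive : ∀ x → f (f x) ≡ x
    involutive x = trans (cong (ι ∘ reverseUpTo k) (toℕ-ι-< (reverse-< k<n (toℕ<n x))))
                     (trans (cong ι (reverse-involutive k (toℕ x))) (ι-toℕ x))

  RotationInvariant : SimpleGraph n → Set
  RotationInvariant G = ∀ x y → adj G (next x) (next y) ≡ adj G x y

  ContainsCycle : SimpleGraph n → Set
  ContainsCycle G = ∀ x → adj G x (next x) ≡ true

  module _ (G : SimpleGraph n) where
    edge : ℕ → ℕ → Bool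
    edge i j = adj G (ι i) (ι j)

    -- The function S of the overview.
    distance : ℕ → Bool
    distance = edge 0

    edge-sym′ : ∀ i j → edge i j ≡ edge j i
    edge-sym′ i j = symm G (ι i) (ι j)

  module _ {G : SimpleGraph n} (inv : RotationInvariant G) where
    edge-shift : ∀ c i j → edge G (c + i) (c + j) ≡ edge G i j
    edge-shift zero    i j = refl
    edge-shift (suc c) i j = trans (cong₂ (adj G) (sym (next-ι (c + i))) (sym (next-ι (c + j))))
                               (trans (inv _ _) (edge-shift c i j))

    edge-distance : ∀ i d → edge G i (i + d) ≡ distance G d
    edge-distance i d = trans (cong (λ t → edge G t (i + d)) (sym (+-identityʳ i))) (edge-shift i 0 d)

    -- Going `e` steps on from `d` ends at `n`, which is vertex 0 again.
    distance-complement : ∀ d e → d + e ≡ n → distance G d ≡ distance G e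
    distance-complement d e d+e≡n = sym (begin
      distance G e     ≡⟨ edge-distance d e ⟨
      edge G d (d + e) ≡⟨ cong (adj G (ι d)) (trans (cong ι d+e≡n) ι-n) ⟩
      edge G d 0       ≡⟨ edge-sym′ G d 0 ⟩
      distance G d     ∎)
      where open ≡-Reasoning

  circulant-≈ : ∀ {G H} → RotationInvariant G → RotationInvariant H →
                (∀ d → 1 ≤ d → d < n → distance G d ≡ distance H d) → G ≈G H
  circulant-≈ {G} {H} invG invH eq x y =
    [ ordered x y , (λ y≤x → trans (symm G x y) (trans (ordered y x y≤x) (symm H y x))) ]′
      (≤-total (toℕ x) (toℕ y))
    where
    distances : ∀ d → d < n → distance G d ≡ distance H d
    distances zero    _   = trans (irrefl G (ι 0)) (sym (irrefl H (ι 0)))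
    distances (suc d) d<n = eq (suc d) (s≤s z≤n) d<n

    as-distance : ∀ {K} → RotationInvariant K → ∀ x y → toℕ x ≤ toℕ y → adj K x y ≡ distance K (toℕ y ∸ toℕ x)
    as-distance {K} inv x y x≤y = trans
      (cong₂ (adj K) (sym (ι-toℕ x)) (trans (sym (ι-toℕ y)) (cong ι (sym (m+[n∸m]≡n x≤y)))))
      (edge-distance {K} inv (toℕ x) (toℕ y ∸ toℕ x))

    ordered : ∀ x y → toℕ x ≤ toℕ y → adj G x y ≡ adj H x y
    ordered x y x≤y = trans (as-distance {G} invG x y x≤y)
      (trans (distances _ (≤-<-trans (m∸n≤m (toℕ y) (toℕ x)) (toℕ<n y)))
        (sym (as-distance {H} invH x y x≤y)))

  -- The hypothesis `inv` says that the rotation along every Hamiltonian cycle `β` of `G` is an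
  -- automorphism of `G`, expressed in positions along `β`.
  module _ (3≤n : 3 ≤ n) {G : SimpleGraph n} (G⊇C : ContainsCycle G)
           (inv : ∀ β → Embeds G β → RotationInvariant (pull β G)) where
    private
      S : ℕ → Bool
      S = distance G

    rotationInvariant : RotationInvariant G
    rotationInvariant = inv Perm.id G⊇C

    edge-suc : ∀ i → edge G i (suc i) ≡ true
    edge-suc i = trans (cong (adj G (ι i)) (sym (next-ι i))) (G⊇C (ι i))

    distance-last : ∀ {d} → suc d ≡ n → S d ≡ true
    distance-last {d} e = trans (distance-complement {G} rotationInvariant d 1 (trans (+-comm d 1) e)) (edge-suc 0)

    -- The two edges at which the reversed cycle leaves the standard one, {0, k} and {1, k+1}, have distance k.
    reversal-embeds : ∀ {k} → 2 ≤ k → (k+3≤n : k + 3 ≤ n) → S k ≡ true →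
                      ∀ (k<n : k < n) → Embeds G (segmentReversal k<n)
    reversal-embeds {k} 2≤k k+3≤n Sk k<n x with next-cases x
    -- The closing edge: `k + 3 ≤ n` puts the last vertex beyond the segment, so both its ends stay
    -- fixed.
    ... | inj₂ (e , f) = trans (cong₂ (adj G)
            (cong ι (reverse-outside (toℕ x) (<⇒≤ (≤-pred (subst₂ _≤_ (+-comm k 3) (sym e) k+3≤n)))))
            (trans (cong (ι ∘ reverseUpTo k) (trans (cong toℕ f) toℕ-ι0)) (sym (trans (cong ι e) ι-n))))
            (edge-suc (toℕ x))
    ... | inj₁ (lt , e) rewrite e = at (position k (toℕ x))
      where
      at : ∀ {i} → Position k i → edge G (reverseUpTo k i) (reverseUpTo k (suc i)) ≡ true
      at start = trans (cong (edge G 0) (reverse-inside 0 (pred k) (1+pred≡ 2≤k)))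
                   (trans (cong S (1+pred≡ 2≤k)) Sk)
      at (inside i zero e) = trans (cong₂ (edge G) (reverse-inside i 0 e)
                                (trans (reverse-outside (suc (suc i)) (≤-reflexive (cong suc k≡))) (cong suc (sym k≡))))
                              (trans (edge-distance {G} rotationInvariant 1 k) Sk)
        where k≡ = trans (sym e) (+-identityʳ (suc i))
      at (inside i (suc j) e) = trans
        (cong₂ (edge G) (reverse-inside i (suc j) e) (reverse-inside (suc i) j (trans (sym (+-suc (suc i) j)) e)))
        (trans (edge-sym′ G (suc (suc j)) (suc j)) (edge-suc (suc j)))
      at (outside {i} k<i) = trans
        (cong₂ (edge G) (reverse-outside i k<i) (reverse-outside (suc i) (m<n⇒m<1+n k<i))) (edge-suc i)

    module _ {k} (2≤k : 2 ≤ k) (k+3≤n : k + 3 ≤ n) (Sk : S k ≡ true) where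
      private
        k<n : k < n
        k<n = ≤-trans (≤-trans (≤-reflexive (+-comm 1 k)) (+-monoʳ-≤ k (s≤s z≤n))) k+3≤n

      -- This is `inv` for the reversed cycle; the bounds on `i` and `j` keep the rotation from
      -- wrapping around.
      reversed-shift : ∀ i j → suc i < n → suc j < n →
        edge G (reverseUpTo k (suc i)) (reverseUpTo k (suc j)) ≡ edge G (reverseUpTo k i) (reverseUpTo k j)
      reversed-shift i j i<n j<n = begin
        edge G (r (suc i)) (r (suc j))
          ≡⟨ cong₂ (λ a b → edge G (r a) (r b)) (at-suc i i<n) (at-suc j j<n) ⟨
        adj G (ι (r (toℕ (next (ι i))))) (ι (r (toℕ (next (ι j)))))
          ≡⟨ inv (segmentReversal k<n) (reversal-embeds 2≤k k+3≤n Sk k<n) (ι i) (ι j) ⟩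
        adj G (ι (r (toℕ (ι i)))) (ι (r (toℕ (ι j))))
          ≡⟨ cong₂ (λ a b → edge G (r a) (r b)) (toℕ-ι-< (<⇒≤ i<n)) (toℕ-ι-< (<⇒≤ j<n)) ⟩
        edge G (r i) (r j) ∎
        where
        open ≡-Reasoning
        r = reverseUpTo k
        at-suc : ∀ i → suc i < n → toℕ (next (ι i)) ≡ suc i
        at-suc i i<n = trans (cong toℕ (next-ι i)) (toℕ-ι-< i<n)

      -- Rotating the reversed cycle moves position i of the reversed segment one step down
      -- and position j beyond it one step up.
      distance-across : ∀ i u d → suc (suc i) + u ≡ k → k < suc (suc u) + d → suc (suc (suc u) + d) < n →
                        S d ≡ S (2 + d)
      distance-across i u d e k<j j<n = sym (begin
        S (2 + d)
          ≡⟨ edge-distance {G} rotationInvariant (suc u) (2 + d) ⟨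
        edge G (suc u) (suc u + (2 + d))
          ≡⟨ cong (edge G (suc u)) (trans (+-suc (suc u) (suc d)) (cong suc (+-suc (suc u) d))) ⟩
        edge G (suc u) (suc j)
          ≡⟨ cong₂ (edge G) (reverse-inside (suc i) u e) (reverse-outside (suc j) (m<n⇒m<1+n k<j)) ⟨
        edge G (r (suc (suc i))) (r (suc j))
          ≡⟨ reversed-shift (suc i) j i<n j<n ⟩
        edge G (r (suc i)) (r j)
          ≡⟨ cong₂ (edge G) (reverse-inside i (suc u) (trans (+-suc (suc i) u) e)) (reverse-outside j k<j) ⟩
        edge G (suc (suc u)) (suc (suc u) + d)
          ≡⟨ edge-distance {G} rotationInvariant (suc (suc u)) d ⟩
        S d ∎)
        where
        open ≡-Reasoning
        r = reverseUpTo k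
        -- Chosen at distance `d` from `2 + u`, the vertex at position `suc i`. The rotation takes
        -- these two vertices to `j + 1` and `1 + u`, at distance `d + 2`.
        j = suc (suc u) + d
        i<n : suc (suc i) < n
        i<n = ≤-<-trans (subst (suc (suc i) ≤_) e (m≤m+n (suc (suc i)) u)) k<n

      -- The pair at distance `d` must straddle the end of the segment. For `d < k` its upper vertex
      -- is put at `k + 1`, and `k + 3 ≤ n` leaves room for the rotation. For `d ≥ k` the pair is 2
      -- and `d + 2`, with room by `d + 4 ≤ n`.
      distance-step : ∀ d → 1 ≤ d → d + 4 ≤ n → S d ≡ S (2 + d)
      distance-step (suc d) _ d+4≤n with suc d ≤? pred k
      ... | yes d<k = distance-across d u (suc d) e (s≤s (≤-reflexive (sym j≡k)))
                        (subst (_≤ n) (trans (+-comm k 3) (cong (3 +_) (sym j≡k))) k+3≤n)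
        where
        u = k ∸ suc (suc d)
        e : suc (suc d) + u ≡ k
        e = m+[n∸m]≡n (subst (suc (suc d) ≤_) (1+pred≡ 2≤k) (s≤s d<k))
        j≡k : suc u + suc d ≡ k
        j≡k = trans (trans (+-comm (suc u) (suc d)) (+-suc (suc d) u)) e
      ... | no d≮k = distance-across (k ∸ 2) 0 (suc d)
                       (trans (+-identityʳ _) (m+[n∸m]≡n 2≤k))
                       (m<n⇒m<1+n (s≤s (subst (_≤ suc d) (1+pred≡ 2≤k) (≰⇒> d≮k))))
                       (subst (_≤ n) (+-comm (suc d) 4) d+4≤n)

    -- If `S 2` holds, then `S 1` and the step by 2 give every distance. If it fails but some chord
    -- `k` exists, the step by 2 leaves exactly the odd distances. With no such chord only the
    -- distances 1 and `n - 1` remain.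
    classification : G ≈G cycleG n ⊎ G ≈G completeG n ⊎ (odd n ≡ false × G ≈G parityG n)
    classification with S 2 in S2
    ... | true = inj₂ (inj₁ (circulant-≈ {G} {completeG n} rotationInvariant (λ x y → complete-aut rotation x y)
                   λ d 1≤d d<n → trans (all d 1≤d d<n) (sym (complete-edge λ e →
                     n≮0 (subst (1 ≤_) (trans (sym (toℕ-ι-< d<n)) (trans (cong toℕ (sym e)) toℕ-ι0)) 1≤d)))))
      where
      all : ∀ d → 1 ≤ d → d < n → S d ≡ true
      all 1 _ _ = edge-suc 0
      all 2 _ _ = S2
      all (suc (suc (suc d))) _ d<n =
        -- Away from distance `n - 1` there are at least five vertices, so 2 itself serves as the
        -- chord.
        [ (λ lt → trans
            (sym (distance-step {2} ≤-refl (≤-trans (s≤s (s≤s (s≤s (s≤s (s≤s z≤n))))) lt) S2 (suc d) (s≤s z≤n)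
              (≤-trans (≤-reflexive (cong suc (+-comm d 4))) lt)))
            (all (suc d) (s≤s z≤n) (<⇒≤ (<⇒≤ d<n))))
        , distance-last ]′ (m≤n⇒m<n∨m≡n d<n)
    ... | false with anyUpTo? (λ k → (2 ≤? k) ×-dec (k + 3 ≤? n) ×-dec (S k Bool.≟ true)) n
    ...   | yes (k , _ , 2≤k , k+3≤n , Sk) =
      inj₂ (inj₂ (even , circulant-≈ {G} {parityG n} rotationInvariant parity-invariant distances))
      where
      below : ∀ d → 1 ≤ d → 2 + d ≤ n → S d ≡ odd d
      below 1 _ _ = edge-suc 0
      below 2 _ _ = S2
      below (suc (suc (suc d))) _ ≤n = trans
        (sym (distance-step 2≤k k+3≤n Sk (suc d) (s≤s z≤n)
          (≤-trans (≤-reflexive (cong suc (+-comm d 4))) ≤n)))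
        (trans (below (suc d) (s≤s z≤n) (<⇒≤ (<⇒≤ ≤n))) (sym (Bool.not-involutive _)))
      n≡ : 2 + (n ∸ 2) ≡ n
      n≡ = m+[n∸m]≡n (<⇒≤ 3≤n)
      even : odd n ≡ false
      even = trans (cong odd (sym n≡)) (trans (Bool.not-involutive (odd (n ∸ 2)))
        -- Distance `n - 2` is the complement of 2, so `S` is false there, while `below` says that
        -- it is the parity of `n - 2`.
        (trans (sym (below (n ∸ 2) (∸-monoˡ-≤ 2 3≤n) (≤-reflexive n≡)))
          (trans (sym (distance-complement {G} rotationInvariant 2 (n ∸ 2) n≡)) S2)))
      parity-invariant : RotationInvariant (parityG n)
      parity-invariant x y = trans
        (cong₂ _xor_ (odd-alternating even x) (odd-alternating even y))
        (Bool.xor-annihilates-not (odd (toℕ x)) (odd (toℕ y)))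
      S≡odd : ∀ d → 1 ≤ d → d < n → S d ≡ odd d
      S≡odd d 1≤d d<n with m≤n⇒m<n∨m≡n d<n
      ... | inj₁ lt = below d 1≤d lt
      ... | inj₂ e  = trans (distance-last e)
              (trans (sym (cong not (trans (cong odd e) even))) (Bool.not-involutive (odd d)))
      distances : ∀ d → 1 ≤ d → d < n → S d ≡ distance (parityG n) d
      distances d 1≤d d<n = trans (S≡odd d 1≤d d<n)
        (sym (cong₂ (λ a b → odd a xor odd b) toℕ-ι0 (toℕ-ι-< d<n)))
    ...   | no ¬chord = inj₁ (circulant-≈ {G} {cycleG n} rotationInvariant (rotation-aut 3≤n) distances)
      where
      cycle-distance : ∀ d → 1 < d → suc d < n → distance (cycleG n) d ≡ false
      cycle-distance d 1<d d<n = Bool.¬-not λ e → case cycle-edge⁻ (ι 0) (ι d) e of λ where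
        (inj₁ f) → <⇒≢ 1<d (sym (trans (sym (toℕ-ι-< (<⇒≤ d<n)))
                     (trans (cong toℕ (trans f (next-ι 0))) (toℕ-ι-< (1<n 3≤n)))))
        (inj₂ f) → 1+n≢0 (trans (sym (toℕ-ι-< d<n)) (trans (cong toℕ (sym (trans f (next-ι d)))) toℕ-ι0))
      no-chord : ∀ d → 1 < d → suc d < n → S d ≡ false
      no-chord d 1<d d<n with m≤n⇒m<n∨m≡n d<n
      -- Distance `n - 2` lies outside the range of the chord search and is settled by `S 2`.
      ... | inj₂ e  = trans (distance-complement {G} rotationInvariant d 2 (trans (+-comm d 2) e)) S2
      ... | inj₁ lt = Bool.¬-not λ Sd → ¬chord (d , <⇒≤ d<n , 1<d , ≤-trans (≤-reflexive (+-comm d 3)) lt , Sd)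
      distances : ∀ d → 1 ≤ d → d < n → S d ≡ distance (cycleG n) d
      distances d 1≤d d<n with m≤n⇒m<n∨m≡n 1≤d | m≤n⇒m<n∨m≡n d<n
      ... | inj₂ refl | _ = trans (edge-suc 0)
              (sym (trans (cong (adj (cycleG n) (ι 0)) (sym (next-ι 0))) (cycle-next 3≤n (ι 0))))
      ... | inj₁ _ | inj₂ e = trans (distance-last e)
              (sym (cycle-edge⁺ 3≤n {ι 0} {ι d} (inj₂ (sym (trans (next-ι d) (trans (cong ι e) ι-n))))))
      ... | inj₁ 1<d | inj₁ lt = trans (no-chord d 1<d lt) (sym (cycle-distance d 1<d lt))

-- From circulant and rigid graphs to strong fixing Hamiltonian cycles.

module _ {n : ℕ} where
  iso-trans : ∀ {G H K : SimpleGraph n} → Iso G H → Iso H K → Iso G K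
  iso-trans {G} {H} {K} (π , isoπ) (ρ , isoρ) = π ∘ₚ ρ , isIso-∘ {n} {G} {H} {K} π ρ isoπ isoρ

  iso-sym : ∀ {G H : SimpleGraph n} → Iso G H → Iso H G
  iso-sym {G} {H} (π , iso) = flip π , isIso-flip {n} {G} {H} π iso

module Hamiltonian (n : ℕ) .⦃ _ : NonZero n ⦄ (3≤n : 3 ≤ n) where
  open Cyclic n
  open Circulant n

  AllStrongFixing : SimpleGraph n → Set
  AllStrongFixing G = (Σ (SimpleGraph n) λ H → IsHamCycle G H) × (∀ H → IsHamCycle G H → StrongFixing H G)

  embeds⇒sub : ∀ {G β} → Embeds G β → SpanningSub (pull (flip β) (cycleG n)) G
  embeds⇒sub {G} {β} emb x y e = subst₂ (λ a b → adj G a b ≡ true) (inverseʳ β) (inverseʳ β)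
    (embeds⇒edge G {β} emb (cycle-edge⁻ (β ⟨$⟩ˡ x) (β ⟨$⟩ˡ y) e))

  -- Since `α` sends a vertex of `H` to its position, `flip α` lists the vertices in cyclic order.
  sub⇒embeds : ∀ {G H} → SpanningSub H G → ∀ α → IsIso H (cycleG n) α → Embeds G (flip α)
  sub⇒embeds {G} {H} H⊆G α iso x = H⊆G _ _ (trans (isIso-flip {n} {H} {cycleG n} α iso x (next x)) (cycle-next 3≤n x))

  module _ {G M : SimpleGraph n} (M⊇C : ContainsCycle M) (rigid : Rigid M) (G≅M : Iso G M) where
    private
      φ : Permutation′ n
      φ = proj₁ G≅M

      isoφ : IsIso G M φ
      isoφ = proj₂ G≅M

    -- Listing `H` and then applying `φ` embeds the standard cycle in `M`, hence is an automorphism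
    -- of `M` by rigidity. Cancelling `φ` leaves `flip α` as an isomorphism from `M` to `G`.
    ham-iso : ∀ {H} → SpanningSub H G → ∀ α → IsIso H (cycleG n) α → IsIso G M α
    ham-iso {H} H⊆G α iso = isIso-flip {n} {M} {G} (flip α)
      (isIso-resp {n} {M} {G} {(flip α ∘ₚ φ) ∘ₚ flip φ} {flip α} (λ x → inverseˡ φ)
        (isIso-∘ {n} {M} {M} {G} (flip α ∘ₚ φ) (flip φ)
          (rigid (flip α ∘ₚ φ) λ x → trans (isoφ _ _) (sub⇒embeds {G} {H} H⊆G α iso x))
          (isIso-flip {n} {G} {M} φ isoφ)))

    -- Both `σ ∘ₚ β` and `β` are position maps, of `H` and `H′`, hence isomorphisms from `G` to `M`;
    -- `σ` is the first followed by the inverse of the second.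
    ham-iso-aut : ∀ {H H′} → IsHamCycle G H → IsHamCycle G H′ → ∀ σ → IsIso H H′ σ → IsAut G σ
    ham-iso-aut {H} {H′} (H⊆G , _) (H′⊆G , β , isoβ) σ isoσ =
      isIso-resp {n} {G} {G} {(σ ∘ₚ β) ∘ₚ flip β} {σ} (λ x → inverseˡ β)
        (isIso-∘ {n} {G} {M} {G} (σ ∘ₚ β) (flip β)
          (ham-iso {H} H⊆G (σ ∘ₚ β) (isIso-∘ {n} {H} {H′} {cycleG n} σ β isoσ isoβ))
          (isIso-flip {n} {G} {M} β (ham-iso {H′} H′⊆G β isoβ)))

    rigid⇒strongFixing : AllStrongFixing G
    rigid⇒strongFixing = hamiltonian , λ H (H⊆G , isoC) → strongFixing {n} {G} {H} H⊆G
      (λ H′ H′⊆G iso →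
        let σ , isoσ = iso-sym {n} {H′} {H} iso
        in σ , ham-iso-aut {H} {H′} (H⊆G , isoC) (H′⊆G , iso-trans {n} {H′} {H} {cycleG n} iso isoC) σ isoσ , isoσ)
      (λ σ → ham-iso-aut {H} {H} (H⊆G , isoC) (H⊆G , isoC) σ)
      where
      hamiltonian : Σ (SimpleGraph n) λ H → IsHamCycle G H
      hamiltonian = pull φ (cycleG n)
        , (λ x y e → trans (sym (isoφ x y)) (embeds⇒edge M {Perm.id} M⊇C (cycle-edge⁻ _ _ e)))
        , φ , λ _ _ → refl

  strongFixing⇒classification : ∀ {G} → AllStrongFixing G →
    Iso G (cycleG n) ⊎ Iso G (completeG n) ⊎ (odd n ≡ false × Iso G (parityG n))
  strongFixing⇒classification {G} ((H , H⊆G , α , iso) , fixing) =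
    [ inj₁ ∘ to {cycleG n}
    , [ inj₂ ∘ inj₁ ∘ to {completeG n} , (λ (even , e) → inj₂ (inj₂ (even , to {parityG n} e))) ]′
    ]′
      (classification 3≤n {M} (sub⇒embeds {G} {H} H⊆G α iso) inv)
    where
    M : SimpleGraph n
    -- The vertices of `G` are renamed by their positions on `H`, which makes `H` the standard
    -- cycle.
    M = pull (flip α) G

    to : ∀ {K} → M ≈G K → Iso G K
    to {K} M≈K = α , λ x y → trans (sym (M≈K _ _)) (cong₂ (adj G) (inverseˡ α) (inverseˡ α))

    -- Read in `G`, `β` lists a Hamiltonian cycle `Hγ`. Its rotation `ρ` is an automorphism of `Hγ`,
    -- hence of `G` by strong fixing.
    inv : ∀ β → Embeds M β → RotationInvariant (pull β M)
    inv β emb x y = trans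
      (sym (cong₂ (λ a b → adj G (γ ⟨$⟩ʳ next a) (γ ⟨$⟩ʳ next b)) (inverseˡ γ) (inverseˡ γ)))
      (proj₂ (fixing Hγ (embeds⇒sub {G} {γ} emb , flip γ , λ _ _ → refl)) ρ ρ-aut (γ ⟨$⟩ʳ x) (γ ⟨$⟩ʳ y))
      where
      γ = β ∘ₚ flip α
      ρ = flip γ ∘ₚ rotation ∘ₚ γ
      Hγ = pull (flip γ) (cycleG n)
      ρ-aut : IsAut Hγ ρ
      ρ-aut x y = trans (cong₂ (adj (cycleG n)) (inverseˡ γ) (inverseˡ γ)) (rotation-aut 3≤n _ _)

  parity-contains : odd n ≡ false → ContainsCycle (parityG n)
  parity-contains even x = trans (cong (odd (toℕ x) xor_) (odd-alternating even x)) (xor-not (odd (toℕ x)))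

  classification⇒strongFixing : ∀ {G} →
    Iso G (cycleG n) ⊎ Iso G (completeG n) ⊎ (odd n ≡ false × Iso G (parityG n)) → AllStrongFixing G
  classification⇒strongFixing {G} (inj₁ iso) =
    rigid⇒strongFixing {G} {cycleG n} (cycle-next 3≤n) (cycle-rigid 3≤n) iso
  classification⇒strongFixing {G} (inj₂ (inj₁ iso)) =
    rigid⇒strongFixing {G} {completeG n} (λ x → complete-edge (next≢ 3≤n x)) (λ π _ → complete-aut π) iso
  classification⇒strongFixing {G} (inj₂ (inj₂ (even , iso))) =
    rigid⇒strongFixing {G} {parityG n} (parity-contains even) parity-rigid iso

-- Matching the parity parts with the two halves.

odd-double : ∀ h → odd (h + h) ≡ false
odd-double zero    = refl
odd-double (suc h) = trans (cong (not ∘ odd) (+-suc h h)) (trans (Bool.not-involutive _) (odd-double h))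

even⇒double : ∀ n → odd n ≡ false → Σ ℕ λ h → n ≡ h + h
even⇒double zero          _ = 0 , refl
even⇒double (suc (suc n)) e with h , n≡ ← even⇒double n (trans (sym (Bool.not-involutive _)) e) =
  suc h , cong suc (trans (cong suc n≡) (sym (+-suc h h)))

module _ {n h : ℕ} (n≡h+h : n ≡ h + h) where
  private
    n≡h*2 : n ≡ h * 2
    n≡h*2 = trans n≡h+h (trans (cong (h +_) (sym (+-identityʳ h))) (*-comm 2 h))
    n≡2*h : n ≡ 2 * h
    n≡2*h = trans n≡h*2 (*-comm h 2)

    -- 2 i + j ↦ h j + i
    swapDigits : Permutation (h * 2) (2 * h)
    swapDigits = permutation (swap h 2) (swap 2 h) (swap-swap 2 h) (swap-swap h 2)
      where
      swap : ∀ a b → Fin (a * b) → Fin (b * a)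
      swap a b x = let i , j = remQuot {a} b x in combine j i
      swap-swap : ∀ a b x → swap b a (swap a b x) ≡ x
      swap-swap a b x = let i , j = remQuot {a} b x in
        trans (cong (λ (j , i) → combine i j) (remQuot-combine j i)) (combine-remQuot {a} b x)

    -- The digit `j` is the parity of `2 i + j` and also tells in which half `h j + i` lies.
    side : ∀ (i : Fin h) (j : Fin 2) → (toℕ (combine j i) <ᵇ h) ≡ not (odd (toℕ (combine i j)))
    side i j = trans (cong (_<ᵇ h) (toℕ-combine j i)) (sym (trans (cong (not ∘ odd) (toℕ-combine i j)) (sided j)))
      where
      sided : ∀ j → not (odd (2 * toℕ i + toℕ j)) ≡ (h * toℕ j + toℕ i <ᵇ h)
      sided zero = trans
        (cong not (trans (cong odd (trans (+-identityʳ _) (cong (toℕ i +_) (+-identityʳ _)))) (odd-double (toℕ i))))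
        (sym (trans (cong (λ t → t + toℕ i <ᵇ h) (*-zeroʳ h)) (Equivalence.to Bool.T-≡ (<⇒<ᵇ (toℕ<n i)))))
      sided (suc zero) = trans (cong (not ∘ odd) (trans (+-comm _ 1) (cong (λ t → suc (toℕ i + t)) (+-identityʳ _))))
        (trans (cong (not ∘ not) (odd-double (toℕ i)))
          (sym (Bool.¬-not λ e → m+n≮m h (toℕ i)
            (subst (λ t → t + toℕ i < h) (*-identityʳ h) (<ᵇ⇒< _ h (Equivalence.from Bool.T-≡ e))))))

    part : ∀ x → (toℕ (swapDigits ⟨$⟩ʳ x) <ᵇ h) ≡ not (odd (toℕ x))
    part x = trans (side _ _) (cong (not ∘ odd ∘ toℕ) (combine-remQuot {h} 2 x))

  parity≅bip : Iso (parityG n) (bipG n h)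
  parity≅bip = cast-id n≡h*2 ∘ₚ swapDigits ∘ₚ cast-id (sym n≡2*h) , λ x y →
    -- Even vertices land below `h`, so both colours are negated, which leaves their `xor`
    -- unchanged.
    trans (cong₂ _xor_ (sides x) (sides y)) (Bool.xor-annihilates-not (odd (toℕ x)) (odd (toℕ y)))
    where
    sides : ∀ x → (toℕ (cast (sym n≡2*h) (swapDigits ⟨$⟩ʳ cast n≡h*2 x)) <ᵇ h) ≡ not (odd (toℕ x))
    sides x = trans (cong (_<ᵇ h) (toℕ-cast _ _))
      (trans (part (cast n≡h*2 x)) (cong (not ∘ odd) (toℕ-cast n≡h*2 x)))

theorem6 : (n : ℕ) → 3 ≤ n → (G : SimpleGraph n) →
    ((Σ (SimpleGraph n) λ H → IsHamCycle G H)
    × (∀ H → IsHamCycle G H → StrongFixing H G))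
    ⇔ (Iso G (cycleG n)
    ⊎ Iso G (completeG n)
    ⊎ (Σ ℕ λ h → (n ≡ h + h) × Iso G (bipG n h)))
theorem6 n 3≤n G = mk⇔
  (λ fixing → case strongFixing⇒classification {G} fixing of λ where
    (inj₁ iso)                  → inj₁ iso
    (inj₂ (inj₁ iso))           → inj₂ (inj₁ iso)
    (inj₂ (inj₂ (even , iso))) → let h , n≡ = even⇒double n even in
      inj₂ (inj₂ (h , n≡ , iso-trans {n} {G} {parityG n} {bipG n h} iso (parity≅bip {n} {h} n≡))))
  (λ where
    (inj₁ iso)                    → classification⇒strongFixing {G} (inj₁ iso)
    (inj₂ (inj₁ iso))             → classification⇒strongFixing {G} (inj₂ (inj₁ iso))
    (inj₂ (inj₂ (h , refl , iso))) → classification⇒strongFixing {G} (inj₂ (inj₂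
      (odd-double h , iso-trans {n} {G} {bipG n h} {parityG n} iso
        (iso-sym {n} {parityG n} {bipG n h} (parity≅bip {h + h} {h} refl))))))
  where
  instance
    nonZero : NonZero n
    nonZero = >-nonZero (≤-trans (s≤s z≤n) 3≤n)
  open Hamiltonian n 3≤n
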